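{- Let $n\geq 2$ and let $f=1^{x_{1}}0^{y_{1}}1^{x_{2}}0^{y_{2}}\cdots 1^{x_{n}}0^{y_{n}}$ with integers $x_i\geq 1$, $y_i\geq 1$ for $i=1,\ldots,n$. If $x_{n}\geq x_{1}+2$ and $y_{1}\geq y_{n}+2$, then $Q_{d}(f)\not\hookrightarrow Q_{d}$ for all $d\geq 2\sum_{i=2}^{n}x_{i}+2\sum_{i=1}^{n-1}y_{i}+x_{1}+y_{n}-2$.
   Context: All strings are binary; $1^a$ (resp. $0^a$) denotes the string of $a$ consecutive ones (resp. zeros), and juxtaposition is concatenation. $Q_d$ is the $d$-dimensional hypercube: its vertices are the binary strings of length $d$, two being adjacent iff they differ in exactly one bit. A string $f$ is a factor of $\mu$ if $f$ appears as $|f|$ consecutive bits of $\mu$. The generalized Fibonacci cube $Q_d(f)$ is the subgraph of $Q_d$ induced by all strings of length $d$ that do not contain $f$ as a factor. A subgraph $H$ of a connected graph $G$ is an isometric subgraph, written $H\hookrightarrow G$ (and $H\not\hookrightarrow G$ otherwise), if $d_H(\mu,\nu)=d_G(\mu,\nu)$ for all $\mu,\nu\in V(H)$ (with $d_H=\infty$ for vertices in different components of $H$). -}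

module Defs where

open import Data.Bool using (Bool; true; false)
open import Data.List using (List; replicate; _++_; concat)
open import Data.List.Relation.Binary.Infix.Heterogeneous using (Infix)
open import Data.Nat using (ℕ; zero; suc; _≤_)
open import Data.Product using (∃!; _,_)
open import Data.Refinement using (Refinement; value)
open import Data.Vec as Vec using (Vec; lookup; zipWith)
open import Function.Base using (_on_)
open import Function.Bundles using (_⇔_)
open import Relation.Binary.Core using (Rel)
open import Relation.Binary.Definitions using (Symmetric; Irreflexive)
open import Relation.Binary.PropositionalEquality using (_≡_; _≢_; refl; ≢-sym)
open import Relation.Nullary using (¬_)
open import Relation.Nullary.Construct.Add.Supremum using (_⁺; [_]; ⊤⁺)
open import Relation.Unary using (Pred)

record Graph : Set₁ where
  field
    Vertex : Set
    Adj    : Rel Vertex _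
    sym    : Symmetric Adj
    irrefl : Irreflexive _≡_ Adj

open Graph

data Walk (G : Graph) : Vertex G → Vertex G → ℕ → Set where
  []  : ∀ {u} → Walk G u u zero
  _∷_ : ∀ {u v w k} → Adj G u v → Walk G v w k → Walk G u w (suc k)

-- The relation d_G(u,v) = k with k ∈ ℕ ∪ {∞}, where ∞ is ⊤⁺. It is a relation
-- because the distance is not computable for an arbitrary graph.
data Distance (G : Graph) (u v : Vertex G) : ℕ ⁺ → Set where
  finite   : ∀ {k} → Walk G u v k → (∀ {l} → Walk G u v l → k ≤ l) →
             Distance G u v [ k ]
  infinite : (∀ {l} → ¬ Walk G u v l) → Distance G u v ⊤⁺

-- Vertices carry their membership proof irrelevantly, so that they are equal
-- as soon as the underlying vertices of G are.
induced : (G : Graph) → Pred (Vertex G) _ → Graph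
induced G P = record
  { Vertex = Refinement (Vertex G) P
  ; Adj    = Adj G on value
  ; sym    = sym G
  ; irrefl = λ { refl → irrefl G refl }
  }

InducedIsometric : (G : Graph) → Pred (Vertex G) _ → Set
InducedIsometric G P = ∀ (u v : Vertex (induced G P)) (k : ℕ ⁺) →
  Distance (induced G P) u v k ⇔ Distance G (value u) (value v) k

-- The bit 1 is true and the bit 0 is false.
DifferInOneBit : ∀ {d} → Rel (Vec Bool d) _
DifferInOneBit u v = ∃! _≡_ λ i → lookup u i ≢ lookup v i

Q : ℕ → Graph
Q d = record
  { Vertex = Vec Bool d
  ; Adj    = DifferInOneBit
  ; sym    = λ { (i , u≢v , unique) → i , ≢-sym u≢v , λ v≢u → unique (≢-sym v≢u) }
  ; irrefl = λ { refl (_ , u≢u , _) → u≢u refl }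
  }

Factor : Rel (List Bool) _
Factor = Infix _≡_

Avoids : ∀ {d} → List Bool → Pred (Vec Bool d) _
Avoids f μ = ¬ Factor f (Vec.toList μ)

-- Q_d(f) is induced (Q d) (Avoids f).
FibCubeIsometric : ℕ → List Bool → Set
FibCubeIsometric d f = InducedIsometric (Q d) (Avoids f)

-- 1^{x₁} 0^{y₁} 1^{x₂} 0^{y₂} ⋯ 1^{xₙ} 0^{yₙ}
blocks : ∀ {n} → Vec ℕ n → Vec ℕ n → List Bool
blocks x y = concat (Vec.toList (zipWith block x y))
  where
  block : ℕ → ℕ → List Bool
  block a b = replicate a true ++ replicate b false

{-# OPTIONS --safe #-}
module Submission where

-- Let two copies of f overlap in x₁ + yₙ + 2 bits. The last bits of the first copy are
-- 1^{x₁} 11 0^{yₙ} and the first bits of the second are 1^{x₁} 00 0^{yₙ}, so they disagree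
-- in two adjacent bits only. Filling these with 11 or 00 produces f, while 10 and 01 do not:
-- write C for the blocks 2, …, n − 1 of f. Up to its first and last block, the word filled
-- with 10 or 01 reads C B C, where B comes from merging the block n with the block 1 and
-- contains fewer than xₙ ones. An occurrence of f would either align its first run of zeros
-- with the shorter one ending B, or give a window of the cyclic word (C B)(C B) that has at
-- most as many blocks as C B, but more ones. Hence the two words filled with 10 and 01 are at
-- distance 2 in the hypercube, but have no common neighbour avoiding f.

open import Defs
open import Data.Bool using (Bool; true; false; not) renaming (_≟_ to _≟ᵇ_)
open import Data.Bool.Properties using (not-¬)
open import Data.Empty using (⊥; ⊥-elim-irr)
open import Data.Fin using (zero; suc)
import Data.Fin.Properties as Fin
open import Data.Irrelevant using ([_])
open import Data.List as List using (List; []; _∷_; _++_; _∷ʳ_; length; replicate; map)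
open import Data.List.Properties
  using (++-assoc; ++-cancelʳ; length-++; length-replicate; length-map; map-++;
         ∷-injective; ∷ʳ-injective; ∷ʳ-injectiveʳ; ∷ʳ-++)
open import Data.List.Relation.Binary.Infix.Heterogeneous using (here; there; _++ⁱ_)
open import Data.List.Relation.Binary.Pointwise as Pointwise using (Pointwise-≡⇒≡)
open import Data.List.Relation.Binary.Prefix.Heterogeneous as Prefix using (Prefix; []; _∷_)
import Data.List.Relation.Binary.Prefix.Heterogeneous.Properties as Prefix
open import Data.Maybe.Base using (just)
open import Data.Nat using (ℕ; zero; suc; _+_; _*_; _∸_; _≤_; _≥_; _<_; z≤n; s≤s)
open import Data.Nat.ListAction using () renaming (sum to sumᴸ)
open import Data.Nat.ListAction.Properties using (sum-++)
open import Data.Nat.Properties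
open import Data.Nat.Tactic.RingSolver using (solve-∀)
open import Data.Product using (_×_; _,_; proj₁; proj₂; ∃₂; ∃-syntax)
open import Data.Refinement using () renaming (_,_ to _⟨,⟩_)
open import Data.Sum using (_⊎_; inj₁; inj₂)
open import Data.Vec as Vec using (Vec; []; _∷_; head; tail; init; last; sum)
open import Data.Vec.Properties using (toList-++; toList∘fromList)
open import Data.Vec.Relation.Unary.All using (All; []; _∷_)
open import Function using (_∘_)
open import Function.Bundles using (Equivalence)
open import Relation.Binary.PropositionalEquality
open import Relation.Nullary using (¬_; contradiction)
open import Relation.Nullary.Decidable using (decidable-stable)
open import Relation.Nullary.Construct.Add.Supremum using () renaming ([_] to fin)

-- Edges and distances in the hypercube

differ-here : ∀ {d b c} {u : Vec Bool d} → b ≢ c → DifferInOneBit (b ∷ u) (c ∷ u)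
differ-here {b = b} {c} {u} b≢c = zero , b≢c , unique
  where
  unique : ∀ {i} → Vec.lookup (b ∷ u) i ≢ Vec.lookup (c ∷ u) i → zero ≡ i
  unique {zero}  _   = refl
  unique {suc _} u≢u = contradiction refl u≢u

differ-there : ∀ {d b} {u v : Vec Bool d} →
               DifferInOneBit u v → DifferInOneBit (b ∷ u) (b ∷ v)
differ-there {b = b} {u} {v} (i , u≢v , unique) = suc i , u≢v , unique′
  where
  unique′ : ∀ {j} → Vec.lookup (b ∷ u) j ≢ Vec.lookup (b ∷ v) j → suc i ≡ j
  unique′ {zero}  b≢b  = contradiction refl b≢b
  unique′ {suc _} u≢v′ = cong suc (unique u≢v′)

differ-++ : ∀ {k d} (h : Vec Bool k) {u v : Vec Bool d} →
            DifferInOneBit u v → DifferInOneBit (h Vec.++ u) (h Vec.++ v)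
differ-++ []      uv = uv
differ-++ (_ ∷ h) uv = differ-there (differ-++ h uv)

-- The hypothesis is doubly negated because the uniqueness in `DifferInOneBit` can only refute a
-- further difference; equality of bits is decidable, so nothing is lost.
lookup-ext : ∀ {d} {u v : Vec Bool d} →
             (∀ i → ¬ (Vec.lookup u i ≢ Vec.lookup v i)) → u ≡ v
lookup-ext {u = []}    {[]}    same = refl
lookup-ext {u = b ∷ u} {c ∷ v} same =
  cong₂ _∷_ (decidable-stable (b ≟ᵇ c) (same zero)) (lookup-ext (same ∘ suc))

differ-∷⁻ : ∀ {d b c} {u v : Vec Bool d} → DifferInOneBit (b ∷ u) (c ∷ v) →
            (b ≢ c × u ≡ v) ⊎ (b ≡ c × DifferInOneBit u v)
differ-∷⁻ (zero , b≢c , unique) =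
  inj₁ (b≢c , lookup-ext λ i u≢v → contradiction (unique {suc i} u≢v) λ ())
differ-∷⁻ {b = b} {c} (suc i , u≢v , unique) =
  inj₂ (decidable-stable (b ≟ᵇ c) (λ b≢c → contradiction (unique {zero} b≢c) λ ())
       , i , u≢v , λ u≢v′ → Fin.suc-injective (unique u≢v′))

-- Words that differ in two adjacent bits

word : ∀ {k l} → Vec Bool k → Vec Bool l → Bool → Bool → Vec Bool (k + (2 + l))
word h t b c = h Vec.++ b ∷ c ∷ t

-- Variable endpoints let the indices of `[]` unify; two concrete words would be stuck on their
-- common part `h`.
walk-zero : ∀ G {u v} → Walk G u v 0 → u ≡ v
walk-zero G [] = refl

walk-one : ∀ G {u v} → Walk G u v 1 → Graph.Adj G u v
walk-one G (uv ∷ []) = uv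

word-10≢01 : ∀ {k l} (h : Vec Bool k) {t : Vec Bool l} →
             word h t true false ≢ word h t false true
word-10≢01 []      ()
word-10≢01 (_ ∷ h) eq = word-10≢01 h (cong tail eq)

word-distance : ∀ {k l} (h : Vec Bool k) (t : Vec Bool l) →
                Distance (Q (k + (2 + l))) (word h t true false) (word h t false true) (fin 2)
word-distance h t = finite
  (_∷_ {v = word h t true true}
    (differ-++ h (differ-there (differ-here λ ())))
    (differ-++ h (differ-here λ ()) ∷ []))
  (shortest h)
  where
  not-adjacent : ∀ {k} (h : Vec Bool k) →
                 ¬ DifferInOneBit (word h t true false) (word h t false true)
  not-adjacent [] uv with differ-∷⁻ uv
  ... | inj₁ (_ , ())
  ... | inj₂ (() , _)
  not-adjacent (_ ∷ h) uv with differ-∷⁻ uv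
  ... | inj₁ (b≢b , _) = b≢b refl
  ... | inj₂ (_ , uv′) = not-adjacent h uv′

  shortest : ∀ {k} (h : Vec Bool k) {n} →
             Walk (Q _) (word h t true false) (word h t false true) n → 2 ≤ n
  shortest h {zero}        walk = contradiction (walk-zero (Q _) walk) (word-10≢01 h)
  shortest h {suc zero}    walk = contradiction (walk-one (Q _) walk) (not-adjacent h)
  shortest h {suc (suc _)} _ = s≤s (s≤s z≤n)

-- If one edge flips a bit of `h`, the other must flip it back; then neither touches the remaining
-- bits, and the fillings 10 and 01 would coincide. So both edges act on the two special bits.
common-neighbours : ∀ {k l} (h : Vec Bool k) (t : Vec Bool l) {z} →
                    DifferInOneBit (word h t true false) z →
                    DifferInOneBit z (word h t false true) →
                    (z ≡ word h t true true) ⊎ (z ≡ word h t false false)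
common-neighbours [] t {a ∷ b ∷ z} uz zv with differ-∷⁻ uz
common-neighbours [] t {true  ∷ _} uz zv | inj₁ (t≢t , _) = contradiction refl t≢t
common-neighbours [] t {false ∷ _} uz zv | inj₁ (_ , refl) = inj₂ refl
common-neighbours [] t {true  ∷ _} uz zv | inj₂ _ with differ-∷⁻ zv
... | inj₁ (_ , refl) = inj₁ refl
... | inj₂ (() , _)
common-neighbours (x ∷ h) t {a ∷ z} uz zv with differ-∷⁻ uz | differ-∷⁻ zv
... | inj₁ (x≢a , _)    | inj₂ (a≡x , _)   = contradiction (sym a≡x) x≢a
... | inj₂ (x≡a , _)    | inj₁ (a≢x , _)   = contradiction (sym x≡a) a≢x
... | inj₁ (_ , refl)   | inj₁ (_ , eq)    = contradiction eq (word-10≢01 h)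
... | inj₂ (refl , uz′) | inj₂ (_ , zv′) with common-neighbours h t uz′ zv′
...   | inj₁ eq = inj₁ (cong (x ∷_) eq)
...   | inj₂ eq = inj₂ (cong (x ∷_) eq)

-- Isometry would carry the distance 2 over to the induced subgraph. The middle vertex of a shortest
-- walk there is a common neighbour, hence the filling 11 or 00, which contains `f`.
critical⇒¬isometric :
  ∀ f h t →
  Factor f (h ++ true ∷ true ∷ t) → Factor f (h ++ false ∷ false ∷ t) →
  ¬ Factor f (h ++ true ∷ false ∷ t) → ¬ Factor f (h ++ false ∷ true ∷ t) →
  ¬ FibCubeIsometric (length h + (2 + length t)) f
critical⇒¬isometric f h t f11 f00 ¬f10 ¬f01 isometric =
  no-walk (Equivalence.from
    (isometric (vec true false ⟨,⟩ [ avoids ¬f10 ]) (vec false true ⟨,⟩ [ avoids ¬f01 ]) (fin 2))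
    (word-distance (Vec.fromList h) (Vec.fromList t)))
  where
  vec : Bool → Bool → Vec Bool (length h + (2 + length t))
  vec = word (Vec.fromList h) (Vec.fromList t)

  toList-vec : ∀ b c → Vec.toList (vec b c) ≡ h ++ b ∷ c ∷ t
  toList-vec b c = trans (toList-++ (Vec.fromList h) _)
    (cong₂ (λ h t → h ++ b ∷ c ∷ t) (toList∘fromList h) (toList∘fromList t))

  avoids : ∀ {b c} → ¬ Factor f (h ++ b ∷ c ∷ t) → Avoids f (vec b c)
  avoids {b} {c} = subst (λ w → ¬ Factor f w) (sym (toList-vec b c))

  not-vertex : ∀ {b c z} → Factor f (h ++ b ∷ c ∷ t) → z ≡ vec b c → .(Avoids f z) → ⊥
  not-vertex {b} {c} fbc refl avoid =
    -- Membership of `z` is known only irrelevantly, which is enough to derive an absurdity.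
    ⊥-elim-irr (avoid (subst (Factor f) (sym (toList-vec b c)) fbc))

  no-walk : ∀ {p q} →
            ¬ Distance (induced (Q _) (Avoids f)) (vec true false ⟨,⟩ p) (vec false true ⟨,⟩ q) (fin 2)
  no-walk (finite (_∷_ {v = z ⟨,⟩ [ avoid ]} uz (zv ∷ [])) _)
    with common-neighbours (Vec.fromList h) (Vec.fromList t) uz zv
  ... | inj₁ z≡11 = not-vertex f11 z≡11 avoid
  ... | inj₂ z≡00 = not-vertex f00 z≡00 avoid

-- Run-length encoding

-- Entries are run lengths minus one, so that every list of pairs encodes a string.
runs : List (ℕ × ℕ) → List Bool
runs []            = []
runs ((a , b) ∷ L) = replicate (suc a) true ++ replicate (suc b) false ++ runs L

runs-++ : ∀ L M → runs (L ++ M) ≡ runs L ++ runs M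
runs-++ []            M = refl
runs-++ ((a , b) ∷ L) M = begin
  ones ++ zeros ++ runs (L ++ M)    ≡⟨ cong (λ z → ones ++ zeros ++ z) (runs-++ L M) ⟩
  ones ++ zeros ++ runs L ++ runs M ≡⟨ cong (ones ++_) (++-assoc zeros (runs L) (runs M)) ⟨
  ones ++ (zeros ++ runs L) ++ runs M ≡⟨ ++-assoc ones (zeros ++ runs L) (runs M) ⟨
  (ones ++ zeros ++ runs L) ++ runs M ∎
  where
  open ≡-Reasoning
  ones  = replicate (suc a) true
  zeros = replicate (suc b) false

length-runs-∷ : ∀ x y L → length (runs ((x , y) ∷ L)) ≡ suc x + (suc y + length (runs L))
length-runs-∷ x y L = trans (length-++ (replicate (suc x) true))
  (cong₂ _+_ (length-replicate (suc x))
    (trans (length-++ (replicate (suc y) false)) (cong (_+ length (runs L)) (length-replicate (suc y)))))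

head-runs : ∀ L → List.head (runs L) ≢ just false
head-runs []      ()
head-runs (_ ∷ _) ()

replicate-++-∷ : ∀ {A : Set} n (x : A) xs →
                 replicate n x ++ x ∷ xs ≡ replicate (suc n) x ++ xs
replicate-++-∷ zero    x xs = refl
replicate-++-∷ (suc n) x xs = cong (x ∷_) (replicate-++-∷ n x xs)

-- Both sides display their maximal initial run of `b`: `not b` closes it on the left, and `z` does
-- not continue it on the right.
run-injective : ∀ b m n {s z} → List.head z ≢ just b →
                replicate m b ++ not b ∷ s ≡ replicate n b ++ z →
                m ≡ n × not b ∷ s ≡ z
run-injective b zero    zero    z≢b eq   = refl , eq
run-injective b zero    (suc n) z≢b eq   = contradiction (sym (proj₁ (∷-injective eq))) (not-¬ refl)
run-injective b (suc m) zero    z≢b refl = contradiction refl z≢b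
run-injective b (suc m) (suc n) z≢b eq
  with m≡n , eq′ ← run-injective b m n z≢b (proj₂ (∷-injective eq)) = cong suc m≡n , eq′

prefix-++ : ∀ (zs : List Bool) {xs ys} → Prefix _≡_ xs ys → Prefix _≡_ (zs ++ xs) (zs ++ ys)
prefix-++ zs = Prefix.++⁺ (Pointwise.refl refl)

runs-prefix⁺ : ∀ M {c e e′} R → e ≤ e′ →
               Prefix _≡_ (runs (M ∷ʳ (c , e))) (runs (M ++ (c , e′) ∷ R))
runs-prefix⁺ [] {c} {e} {e′} R e≤e′ = prefix-++ (replicate (suc c) true) (zeros (s≤s e≤e′))
  where
  zeros : ∀ {m n} → m ≤ n → Prefix _≡_ (replicate m false ++ []) (replicate n false ++ runs R)
  zeros z≤n       = []
  zeros (s≤s m≤n) = refl ∷ zeros m≤n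
runs-prefix⁺ ((a , b) ∷ M) R e≤e′ =
  prefix-++ (replicate (suc a) true) (prefix-++ (replicate (suc b) false) (runs-prefix⁺ M R e≤e′))

starts-with-one : ∀ M {c} → ∃[ rest ] runs (M ∷ʳ c) ≡ true ∷ rest
starts-with-one []      = _ , refl
starts-with-one (_ ∷ _) = _ , refl

-- Every run of the prefix but the final zeros is closed inside it by the opposite bit, so it
-- matches a full run of `L`. The final zeros may continue into `s`, which leaves `e′` free.
runs-prefix⁻ : ∀ M {c e} L s → runs (M ∷ʳ (c , e)) ++ s ≡ runs L →
               ∃₂ λ e′ R → L ≡ M ++ (c , e′) ∷ R
runs-prefix⁻ []      {c} {e} [] s ()
runs-prefix⁻ (_ ∷ _)         [] s ()
runs-prefix⁻ [] {c} {e} ((a′ , b′) ∷ L) s eq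
  with refl , _ ← run-injective true c a′ (λ ())
    (trans (sym (++-assoc (replicate c true) _ s)) (proj₂ (∷-injective eq)))
  = b′ , L , refl
runs-prefix⁻ ((a , b) ∷ M) {c} {e} ((a′ , b′) ∷ L) s eq
  with refl , eq₁ ← run-injective true a a′ (λ ())
    (trans (sym (++-assoc (replicate a true) _ s)) (proj₂ (∷-injective eq)))
  -- The one that opens the next block closes this run of zeros; it has to be exposed for
  -- `run-injective`.
  with rest , M≡ ← starts-with-one M
  with refl , eq₂ ← run-injective false b b′ {rest ++ s} (head-runs L)
    (trans (cong (λ z → replicate b false ++ z ++ s) (sym M≡))
      (trans (sym (++-assoc (replicate b false) _ s)) (proj₂ (∷-injective eq₁))))
  with e′ , R , refl ← runs-prefix⁻ M L s (trans (cong (_++ s) M≡) eq₂)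
  = e′ , R , refl

-- The occurrence starts after the surplus ones of its first block, skipped one at a time, and may
-- stop inside its last run of zeros.
runs-factor⁺ : ∀ L {a a′ b} M {c e e′} R → a ≤ a′ → e ≤ e′ →
               Factor (runs ((a , b) ∷ M ∷ʳ (c , e))) (runs (L ++ (a′ , b) ∷ M ++ (c , e′) ∷ R))
runs-factor⁺ L {a} {a′} {b} M R a≤a′ e≤e′ =
  subst (Factor _) (sym (runs-++ L _)) (runs L ++ⁱ ones a≤a′)
  where
  ones : ∀ {n} → a ≤ n → Factor _ (runs ((n , b) ∷ M ++ (_ , _) ∷ R))
  ones {n} a≤n with m≤n⇒m<n∨m≡n a≤n
  ones {suc n} a≤n | inj₁ (s≤s a≤n′) = there (ones a≤n′)
  ones         a≤n | inj₂ refl       = here (runs-prefix⁺ ((_ , b) ∷ M) R e≤e′)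

-- The factor begins with a one, so it starts inside a run of ones of `W`. What remains of that run,
-- with the rest of `W`, is again an encoding, to which `runs-prefix⁻` applies.
runs-factor⁻ : ∀ {a b} M {c e} W → Factor (runs ((a , b) ∷ M ∷ʳ (c , e))) (runs W) →
               ∃₂ λ L R → ∃₂ λ a′ e′ → W ≡ L ++ (a′ , b) ∷ M ++ (c , e′) ∷ R
runs-factor⁻ M [] (here ())
runs-factor⁻ {a} {b} M {c} {e} ((a₁ , b₁) ∷ W) inf = ones a₁ inf
  where
  f : List Bool
  f = runs ((a , b) ∷ M ∷ʳ (c , e))

  zeros : ∀ n → Factor f (replicate n false ++ runs W) → Factor f (runs W)
  zeros zero    inf               = inf
  zeros (suc n) (there inf)       = zeros n inf
  zeros (suc n) (here (() ∷ _))

  Occurrence : Set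
  Occurrence = ∃₂ λ L R → ∃₂ λ a′ e′ → (a₁ , b₁) ∷ W ≡ L ++ (a′ , b) ∷ M ++ (c , e′) ∷ R

  ones : ∀ n → Factor f (runs ((n , b₁) ∷ W)) → Occurrence
  ones n (here pre) = at-start (Prefix.toView pre) refl
    where
    at-start : ∀ {w} → Prefix.PrefixView _≡_ f w → w ≡ runs ((n , b₁) ∷ W) → Occurrence
    at-start (pw Prefix.++ s) eq
      with refl ← Pointwise-≡⇒≡ pw
      with e′ , R , refl ← runs-prefix⁻ ((a , b) ∷ M) ((n , b₁) ∷ W) s eq
      -- Only `suc n` ones of the run are left here; the witness is the entry `a₁` of the whole run.
      = [] , R , a₁ , e′ , refl
  ones (suc n) (there inf) = ones n inf
  ones zero    (there inf)
    with L , R , a′ , e′ , refl ← runs-factor⁻ M W (zeros (suc b₁) inf)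
    = (a₁ , b₁) ∷ L , R , a′ , e′ , refl

++-++-∷ʳ : ∀ {A : Set} (xs ys zs : List A) z → xs ++ ys ++ zs ∷ʳ z ≡ (xs ++ ys ++ zs) ∷ʳ z
++-++-∷ʳ xs ys zs z = trans (cong (xs ++_) (sym (++-assoc ys zs _))) (sym (++-assoc xs (ys ++ zs) _))

-- Windows of a doubled sequence

prefix-sum-≤ : ∀ V {s} u {u′} → V ++ s ≡ u ++ u′ → length V ≤ length u → sumᴸ V ≤ sumᴸ u
prefix-sum-≤ []      u       eq V≤u       = z≤n
prefix-sum-≤ (v ∷ V) (_ ∷ u) eq (s≤s V≤u) with refl , eq′ ← ∷-injective eq =
  +-monoʳ-≤ v (prefix-sum-≤ V u eq′ V≤u)

-- Rotating u by one letter moves the window one step to the left.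
window-sum-≤ : ∀ p V s u → p ++ V ++ s ≡ u ++ u → length V ≤ length u → sumᴸ V ≤ sumᴸ u
window-sum-≤ []      V s u       eq V≤u = prefix-sum-≤ V u eq V≤u
window-sum-≤ (_ ∷ p) []      s []  eq V≤u = z≤n
window-sum-≤ (x ∷ p) V s (_ ∷ u) eq V≤u with refl , eq′ ← ∷-injective eq =
  subst (sumᴸ V ≤_) rotated-sum
    (window-sum-≤ p V (s ∷ʳ x) (u ∷ʳ x) rotated (subst (length V ≤_) rotated-length V≤u))
  where
  open ≡-Reasoning
  rotated : p ++ V ++ s ∷ʳ x ≡ (u ∷ʳ x) ++ u ∷ʳ x
  rotated = begin
    p ++ V ++ s ∷ʳ x     ≡⟨ ++-++-∷ʳ p V s x ⟩
    (p ++ V ++ s) ∷ʳ x   ≡⟨ cong (_∷ʳ x) eq′ ⟩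
    (u ++ x ∷ u) ∷ʳ x    ≡⟨ ++-assoc u (x ∷ u) _ ⟩
    u ++ x ∷ u ∷ʳ x      ≡⟨ ∷ʳ-++ u x (u ∷ʳ x) ⟨
    (u ∷ʳ x) ++ u ∷ʳ x   ∎
  rotated-length : suc (length u) ≡ length (u ∷ʳ x)
  rotated-length = trans (+-comm 1 (length u)) (sym (length-++ u))
  rotated-sum : sumᴸ (u ∷ʳ x) ≡ x + sumᴸ u
  rotated-sum = trans (sum-++ u _) (trans (+-comm (sumᴸ u) (x + 0)) (cong (_+ sumᴸ u) (+-identityʳ x)))

-- The number of ones in `runs L` minus the number of blocks, as entries are run lengths minus one.
weight : List (ℕ × ℕ) → ℕ
weight = sumᴸ ∘ map proj₁

weight-++ : ∀ L M → weight (L ++ M) ≡ weight L + weight M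
weight-++ L M = trans (cong sumᴸ (map-++ proj₁ L M)) (sum-++ (map proj₁ L) (map proj₁ M))


-- Appending `B` to both sides completes `C ++ B ++ C` to the square of `C ++ B`. The window
-- `C ∷ʳ (c , e)` is no longer than one period but outweighs it, against `window-sum-≤`.
no-heavy-window : ∀ L C {c e} R B → weight B < c → length B ≥ 1 →
                  C ++ B ++ C ≢ L ++ C ++ (c , e) ∷ R
no-heavy-window L C {c} {e} R B B<c B≥1 eq =
  <⇒≱ lighter (window-sum-≤ (map proj₁ L) (map proj₁ V) (map proj₁ (R ++ B)) (map proj₁ (C ++ B))
    doubled V≤u)
  where
  V : List (ℕ × ℕ)
  V = C ∷ʳ (c , e)

  lighter : weight (C ++ B) < weight V
  lighter = begin-strict
    weight (C ++ B)      ≡⟨ weight-++ C B ⟩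
    weight C + weight B  <⟨ +-monoʳ-< (weight C) B<c ⟩
    weight C + c         ≡⟨ cong (weight C +_) (+-identityʳ c) ⟨
    weight C + (c + 0)   ≡⟨ weight-++ C _ ⟨
    weight V             ∎
    where open ≤-Reasoning

  V≤u : length (map proj₁ V) ≤ length (map proj₁ (C ++ B))
  V≤u = begin
    length (map proj₁ V)        ≡⟨ length-map proj₁ V ⟩
    length V                    ≡⟨ length-++ C ⟩
    length C + 1                ≤⟨ +-monoʳ-≤ (length C) B≥1 ⟩
    length C + length B         ≡⟨ length-++ C ⟨
    length (C ++ B)             ≡⟨ length-map proj₁ (C ++ B) ⟨
    length (map proj₁ (C ++ B)) ∎
    where open ≤-Reasoning

  doubled : map proj₁ L ++ map proj₁ V ++ map proj₁ (R ++ B) ≡ map proj₁ (C ++ B) ++ map proj₁ (C ++ B)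
  doubled = begin
    map proj₁ L ++ map proj₁ V ++ map proj₁ (R ++ B) ≡⟨ cong (map proj₁ L ++_) (map-++ proj₁ V (R ++ B)) ⟨
    map proj₁ L ++ map proj₁ (V ++ R ++ B)           ≡⟨ map-++ proj₁ L (V ++ R ++ B) ⟨
    map proj₁ (L ++ V ++ R ++ B)                     ≡⟨ cong (λ z → map proj₁ (L ++ z)) (++-assoc V R B) ⟨
    map proj₁ (L ++ (V ++ R) ++ B)                   ≡⟨ cong (map proj₁) (++-assoc L (V ++ R) B) ⟨
    map proj₁ ((L ++ V ++ R) ++ B)                   ≡⟨ cong (λ z → map proj₁ ((L ++ z) ++ B)) (∷ʳ-++ C (c , e) R) ⟩
    map proj₁ ((L ++ C ++ (c , e) ∷ R) ++ B)         ≡⟨ cong (λ z → map proj₁ (z ++ B)) eq ⟨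
    map proj₁ ((C ++ B ++ C) ++ B)                   ≡⟨ cong (λ z → map proj₁ (z ++ B)) (++-assoc C B C) ⟨
    map proj₁ (((C ++ B) ++ C) ++ B)                 ≡⟨ cong (map proj₁) (++-assoc (C ++ B) C B) ⟩
    map proj₁ ((C ++ B) ++ C ++ B)                   ≡⟨ map-++ proj₁ (C ++ B) (C ++ B) ⟩
    map proj₁ (C ++ B) ++ map proj₁ (C ++ B)         ∎
    where open ≡-Reasoning

-- The four fillings of the overlap

-- An occurrence ending at the last block would align b with q; any other one
-- is excluded by its weight.
merged-avoids : ∀ {a b a₁ b₁ c e e₁ q} C B {p} → weight (B ∷ʳ (p , q)) < c → q ≢ b →
                ¬ Factor (runs ((a , b) ∷ C ∷ʳ (c , e)))
                         (runs ((a₁ , b₁) ∷ C ++ B ∷ʳ (p , q) ++ C ∷ʳ (c , e₁)))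
merged-avoids {b = b} {a₁} {b₁} {c} {e₁ = e₁} {q} C B {p} B<c q≢b occurs
  with L , R , a′ , e′ , eq ← runs-factor⁻ C ((a₁ , b₁) ∷ C ++ B ∷ʳ (p , q) ++ C ∷ʳ (c , e₁)) occurs
  with List.initLast R
... | [] = q≢b (cong proj₂ (∷ʳ-injectiveʳ ((a₁ , b₁) ∷ C ++ B) L ends))
  where
  open ≡-Reasoning
  ends : ((a₁ , b₁) ∷ C ++ B) ∷ʳ (p , q) ≡ L ∷ʳ (a′ , b)
  ends = ++-cancelʳ C _ _ (begin
    (((a₁ , b₁) ∷ C ++ B) ∷ʳ (p , q)) ++ C  ≡⟨ cong (_++ C) (++-assoc ((a₁ , b₁) ∷ C) B _) ⟩
    ((a₁ , b₁) ∷ C ++ B ∷ʳ (p , q)) ++ C    ≡⟨ ++-assoc ((a₁ , b₁) ∷ C) (B ∷ʳ (p , q)) C ⟩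
    (a₁ , b₁) ∷ C ++ B ∷ʳ (p , q) ++ C      ≡⟨ proj₁ (∷ʳ-injective _ _ (begin
      ((a₁ , b₁) ∷ C ++ B ∷ʳ (p , q) ++ C) ∷ʳ (c , e₁) ≡⟨ ++-++-∷ʳ ((a₁ , b₁) ∷ C) (B ∷ʳ (p , q)) C _ ⟨
      (a₁ , b₁) ∷ C ++ B ∷ʳ (p , q) ++ C ∷ʳ (c , e₁)   ≡⟨ eq ⟩
      L ++ (a′ , b) ∷ C ∷ʳ (c , e′)                    ≡⟨ ++-++-∷ʳ L ((a′ , b) ∷ []) C _ ⟩
      (L ++ (a′ , b) ∷ C) ∷ʳ (c , e′)                  ∎)) ⟩
    L ++ (a′ , b) ∷ C                       ≡⟨ ∷ʳ-++ L (a′ , b) C ⟨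
    L ∷ʳ (a′ , b) ++ C                      ∎)
-- The last block of the word lies after the occurrence and can be cut off.
... | R′ List.∷ʳ′ z = heavy L (proj₁ (∷ʳ-injective _ _ (begin
    ((a₁ , b₁) ∷ C ++ B ∷ʳ (p , q) ++ C) ∷ʳ (c , e₁) ≡⟨ ++-++-∷ʳ ((a₁ , b₁) ∷ C) (B ∷ʳ (p , q)) C _ ⟨
    (a₁ , b₁) ∷ C ++ B ∷ʳ (p , q) ++ C ∷ʳ (c , e₁)   ≡⟨ eq ⟩
    L ++ (a′ , b) ∷ C ++ (c , e′) ∷ R′ ∷ʳ z          ≡⟨ ++-++-∷ʳ L ((a′ , b) ∷ C) ((c , e′) ∷ R′) z ⟩
    (L ++ (a′ , b) ∷ C ++ (c , e′) ∷ R′) ∷ʳ z        ∎)))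
  where
  open ≡-Reasoning
  B≥1 : length (B ∷ʳ (p , q)) ≥ 1
  B≥1 = subst (_≥ 1) (sym (length-++ B)) (m≤n+m 1 (length B))

  heavy : ∀ L → (a₁ , b₁) ∷ C ++ B ∷ʳ (p , q) ++ C ≢ L ++ (a′ , b) ∷ C ++ (c , e′) ∷ R′
  -- The first block of the word goes too. It either carries the start of the occurrence or precedes
  -- it; in the latter case `(a′ , b)` joins the part before the window.
  heavy []      eq = no-heavy-window [] C R′ _ B<c B≥1 (proj₂ (∷-injective eq))
  heavy (_ ∷ L) eq = no-heavy-window (L ∷ʳ (a′ , b)) C R′ _ B<c B≥1
    (trans (proj₂ (∷-injective eq)) (sym (∷ʳ-++ L (a′ , b) _)))

-- Trailing zeros pad the word to larger dimensions.
runs-¬isometric : ∀ {a e p q} C t → a ≤ p → e ≤ q →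
  ¬ FibCubeIsometric (12 + (2 * length (runs C) + 2 * p + 2 * q + a + e + t))
                     (runs ((a , 2 + q) ∷ C ∷ʳ (2 + p , e)))
runs-¬isometric {a} {e} {p} {q} C t a≤p e≤q =
  subst (λ d → ¬ FibCubeIsometric d f) length-word
    (critical⇒¬isometric f H T f11 f00 ¬f10 ¬f01)
  where
  A M : List (ℕ × ℕ)
  A = (a , 2 + q) ∷ C
  M = C ∷ʳ (2 + p , t + e)

  f H T : List Bool
  -- With `p + 1` = xₙ - 2 and `q + 1` = y₁ - 2, the bits 11 complete the ones ending `H` to xₙ
  -- ones, and 00 complete the zeros starting `T` to y₁ zeros.
  f = runs (A ∷ʳ (2 + p , e))
  H = runs A ++ replicate (suc p) true
  T = replicate (suc q) false ++ runs M

  word-runs : ∀ {b c} N → replicate (suc p) true ++ b ∷ c ∷ T ≡ runs N →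
              H ++ b ∷ c ∷ T ≡ runs (A ++ N)
  word-runs N eq = trans (++-assoc (runs A) _ _) (trans (cong (runs A ++_) eq) (sym (runs-++ A N)))

  word11 : H ++ true ∷ true ∷ T ≡ runs (A ++ (2 + p , q) ∷ M)
  word11 = word-runs ((2 + p , q) ∷ M)
    (trans (replicate-++-∷ (suc p) true _) (replicate-++-∷ (2 + p) true _))

  word10 : H ++ true ∷ false ∷ T ≡ runs (A ++ (suc p , suc q) ∷ M)
  word10 = word-runs ((suc p , suc q) ∷ M) (replicate-++-∷ (suc p) true _)

  word01 : H ++ false ∷ true ∷ T ≡ runs (A ++ (p , 0) ∷ (0 , q) ∷ M)
  word01 = word-runs ((p , 0) ∷ (0 , q) ∷ M) refl

  word00 : H ++ false ∷ false ∷ T ≡ runs (A ++ (p , 2 + q) ∷ M)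
  word00 = word-runs ((p , 2 + q) ∷ M) refl

  f11 : Factor f (H ++ true ∷ true ∷ T)
  f11 = subst (Factor f) (sym word11) (runs-factor⁺ [] C M ≤-refl e≤q)

  f00 : Factor f (H ++ false ∷ false ∷ T)
  f00 = subst (Factor f) (sym word00) (runs-factor⁺ A C [] a≤p (m≤n+m e t))

  -- One merged block of weight `suc p`, with one zero fewer than the first block of `f`.
  ¬f10 : ¬ Factor f (H ++ true ∷ false ∷ T)
  ¬f10 = merged-avoids C [] (subst (_< 2 + p) (sym (+-identityʳ (suc p))) ≤-refl) (1+n≢n ∘ sym)
         ∘ subst (Factor f) word10

  -- Two merged blocks of total weight `p`, the second with two zeros fewer than the first block of
  -- `f`.
  ¬f01 : ¬ Factor f (H ++ false ∷ true ∷ T)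
  ¬f01 = merged-avoids C ((p , 0) ∷ []) (subst (_< 2 + p) (sym (+-identityʳ p)) (m<n+m p (s≤s z≤n)))
           (m≢1+n+m q)
         ∘ subst (Factor f) word01

  length-word : length H + (2 + length T) ≡ 12 + (2 * length (runs C) + 2 * p + 2 * q + a + e + t)
  length-word = begin
    length H + (2 + length T)
      ≡⟨ cong₂ (λ h t → h + (2 + t)) (length-++ (runs A)) (length-++ (replicate (suc q) false)) ⟩
    length (runs A) + length (replicate (suc p) true)
      + (2 + (length (replicate (suc q) false) + length (runs M)))
      ≡⟨ cong₂ (λ h t → length (runs A) + h + (2 + (t + length (runs M))))
           (length-replicate (suc p)) (length-replicate (suc q)) ⟩
    length (runs A) + suc p + (2 + (suc q + length (runs M)))
      ≡⟨ cong₂ (λ h t → h + suc p + (2 + (suc q + t))) (length-runs-∷ a (2 + q) C)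
           (trans (cong length (runs-++ C _)) (trans (length-++ (runs C))
             (cong (length (runs C) +_) (length-runs-∷ (2 + p) (t + e) [])))) ⟩
    suc a + (3 + q + N) + suc p + (2 + (suc q + (N + (3 + p + (suc (t + e) + 0)))))
      ≡⟨ regroup a e p q t N ⟩
    12 + (2 * N + 2 * p + 2 * q + a + e + t) ∎
    where
    open ≡-Reasoning
    N = length (runs C)
    regroup : ∀ a e p q t N →
      suc a + (3 + q + N) + suc p + (2 + (suc q + (N + (3 + p + (suc (t + e) + 0))))) ≡
      12 + (2 * N + 2 * p + 2 * q + a + e + t)
    regroup = solve-∀

-- From block lengths to run-length encodings

-- Meant for the blocks 2, ..., n, with the last one split off. The final equation counts all their
-- bits except the last zeros; it relates the sums in the dimension bound to the length of `runs C`.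
encode : ∀ {m} (x y : Vec ℕ (suc m)) → All (_≥ 1) x → All (_≥ 1) y →
         ∃[ C ] ∃[ c ] ∃[ e ] blocks x y ≡ runs (C ∷ʳ (c , e)) ×
           last x ≡ suc c × last y ≡ suc e × sum x + sum (init y) ≡ length (runs C) + suc c
encode (suc c ∷ []) (suc e ∷ []) (s≤s _ ∷ _) (s≤s _ ∷ _) =
  [] , c , e , ++-assoc (replicate (suc c) true) (replicate (suc e) false) []
  , refl , refl , trans (+-identityʳ _) (+-identityʳ _)
encode (suc a ∷ x@(_ ∷ _)) (suc b ∷ y@(_ ∷ _)) (s≤s _ ∷ x≥1) (s≤s _ ∷ y≥1)
  with C , c , e , xy≡ , x≡ , y≡ , total ← encode x y x≥1 y≥1
  = (a , b) ∷ C , c , e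
  , trans (++-assoc (replicate (suc a) true) (replicate (suc b) false) (blocks x y))
          (cong (λ z → replicate (suc a) true ++ replicate (suc b) false ++ z) xy≡)
  , x≡ , y≡ , (begin
    suc a + sum x + (suc b + sum (init y))    ≡⟨ regroup (suc a) (suc b) (sum x) (sum (init y)) ⟩
    suc a + (suc b + (sum x + sum (init y)))  ≡⟨ cong (λ z → suc a + (suc b + z)) total ⟩
    suc a + (suc b + (length (runs C) + suc c)) ≡⟨ regroup′ (suc a) (suc b) (suc c) (length (runs C)) ⟩
    suc a + (suc b + length (runs C)) + suc c ≡⟨ cong (_+ suc c) (length-runs-∷ a b C) ⟨
    length (runs ((a , b) ∷ C)) + suc c       ∎)
  where
  open ≡-Reasoning
  regroup : ∀ a b s r → a + s + (b + r) ≡ a + (b + (s + r))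
  regroup = solve-∀
  regroup′ : ∀ a b c n → a + (b + (n + c)) ≡ a + (b + n) + c
  regroup′ = solve-∀

lemma2p3 : ∀ (m : ℕ) (x y : Vec ℕ (2 + m)) →
    All (_≥ 1) x → All (_≥ 1) y →
    last x ≥ head x + 2 →
    head y ≥ last y + 2 →
    ∀ (d : ℕ) →
    d ≥ (2 * sum (tail x) + 2 * sum (init y) + head x + last y) ∸ 2 →
    ¬ FibCubeIsometric d (blocks x y)
lemma2p3 m (suc a ∷ x) (suc b ∷ y) (s≤s _ ∷ x≥1) (s≤s _ ∷ y≥1) xₙ≥x₁+2 y₁≥yₙ+2 d d≥
  with C , c , e , xy≡ , x≡ , y≡ , total ← encode x y x≥1 y≥1
  -- Stripping three successors from x₁ + 2 ≤ xₙ yields `c = 2 + p` with `a ≤ p`; the next line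
  -- likewise yields `b = 2 + q` with `e ≤ q`.
  with s≤s (s≤s (s≤s {n = p} a≤p)) ← subst₂ _≤_ (+-comm (suc a) 2) x≡ xₙ≥x₁+2
  with s≤s (s≤s (s≤s {n = q} e≤q)) ← subst (_≤ suc b) (trans (cong (_+ 2) y≡) (+-comm (suc e) 2)) y₁≥yₙ+2
  = subst₂ (λ d f → ¬ FibCubeIsometric d f)
      -- This equation fixes the padding as the excess of `d` over the bound. As `bound` exposes the
      -- summand 14, the truncated subtraction of 2 computes to 12.
      (m+[n∸m]≡n (subst (_≤ d) (cong (_∸ 2) (bound p q C y≡ total)) d≥))
      (sym (trans (++-assoc (replicate (suc a) true) (replicate (suc b) false) (blocks x y))
        (cong (λ z → replicate (suc a) true ++ replicate (suc b) false ++ z) xy≡)))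
      (runs-¬isometric C _ a≤p e≤q)
  where
  bound : ∀ {e} p q C → last y ≡ suc e → sum x + sum (init y) ≡ length (runs C) + (3 + p) →
          2 * sum x + 2 * (3 + q + sum (init y)) + suc a + last y ≡
          14 + (2 * length (runs C) + 2 * p + 2 * q + a + e)
  bound {e} p q C y≡ total = begin
    2 * sum x + 2 * (3 + q + sum (init y)) + suc a + last y
      ≡⟨ cong (2 * sum x + 2 * (3 + q + sum (init y)) + suc a +_) y≡ ⟩
    2 * sum x + 2 * (3 + q + sum (init y)) + suc a + suc e
      ≡⟨ collect (sum x) (sum (init y)) q a e ⟩
    2 * (sum x + sum (init y)) + 2 * (3 + q) + suc a + suc e
      ≡⟨ cong (λ z → 2 * z + 2 * (3 + q) + suc a + suc e) total ⟩
    2 * (length (runs C) + (3 + p)) + 2 * (3 + q) + suc a + suc e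
      ≡⟨ expand (length (runs C)) p q a e ⟩
    14 + (2 * length (runs C) + 2 * p + 2 * q + a + e) ∎
    where
    open ≡-Reasoning
    collect : ∀ s r q a e → 2 * s + 2 * (3 + q + r) + suc a + suc e ≡
                            2 * (s + r) + 2 * (3 + q) + suc a + suc e
    collect = solve-∀
    expand : ∀ n p q a e → 2 * (n + (3 + p)) + 2 * (3 + q) + suc a + suc e ≡
                           14 + (2 * n + 2 * p + 2 * q + a + e)
    expand = solve-∀
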